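{- For $n \geq 4$, a connected graph $G$ of order $n$ has $\mathrm{vp}^-(G) = n-2$ and $\mathrm{vp}(G) = n-1$ if and only if (i) $G$ is isomorphic to a clique with a non-empty, non-perfect matching deleted, or (ii) $G$ is the join of $K_1$ with a disjoint union of cliques.
   Context: All graphs are finite, undirected and simple. $K_1$ is the one-vertex graph. The join of two graphs is their disjoint union together with all edges between them. A $u,v$-geodesic is a shortest $u,v$-path. For a vertex $x$ of $G$, a set $S \subseteq V(G)$ is an $x$-position set if for every $y \in S$ no vertex of $S \setminus \{y\}$ lies on any $x,y$-geodesic in $G$. The $x$-position number $p_x(G)$ is the maximum cardinality of an $x$-position set of $G$. Define $\mathrm{vp}(G) = \max_{x \in V(G)} p_x(G)$ and $\mathrm{vp}^-(G) = \min_{x \in V(G)} p_x(G)$.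
   Formalization: In (ii) the disjoint union is required to have at least two non-empty cliques; with a single clique the join is the complete graph on n vertices, which has vp⁻ = n−1 instead of n−2, so the literal statement fails there. -}

module Defs where

open import Data.Fin using (Fin)
open import Data.Fin.Properties using (_≟_)
open import Data.Fin.Subset using (Subset; _∈_; ∣_∣)
open import Data.List using (List; []; _∷_)
open import Data.List.Membership.Propositional renaming (_∈_ to _∈ˡ_) using ()
open import Data.List.Relation.Unary.Unique.Propositional using (Unique)
open import Data.Nat using (ℕ; zero; suc; _≤_)
open import Data.Product using (Σ; Σ-syntax; ∃-syntax; _×_; _,_)
open import Data.Sum using (_⊎_; inj₁; inj₂)
open import Data.Unit using (⊤; tt)
open import Function using (_∘_)
open import Function.Bundles using (_↔_; _⇔_; Inverse)
open import Level using (0ℓ)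
open import Relation.Binary using (Rel; Symmetric; Irreflexive; Decidable)
open import Relation.Binary.Construct.Closure.ReflexiveTransitive using (Star; ε; _◅_)
open import Relation.Binary.PropositionalEquality using (_≡_; _≢_; refl; sym)
open import Relation.Nullary using (¬_; yes; no)
open import Relation.Nullary.Decidable using (¬?; _×-dec_)

-- Adjacency is decidable, so that over a finite vertex type (for a graph of
-- order n, Fin n) this is the classical notion of a finite simple graph.
record Graph (V : Set) : Set₁ where
  field
    Adj    : Rel V 0ℓ
    adj?   : Decidable Adj
    symm   : Symmetric Adj
    irrefl : Irreflexive _≡_ Adj

open Graph public

infix 4 _≅_

_≅_ : {V W : Set} → Graph V → Graph W → Set
_≅_ {V} {W} G H =
  Σ[ f ∈ V ↔ W ] (∀ u v → Adj G u v ⇔ Adj H (Inverse.to f u) (Inverse.to f v))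

K : (m : ℕ) → Graph (Fin m)
K m = record
  { Adj    = _≢_
  ; adj?   = λ u v → ¬? (u ≟ v)
  ; symm   = λ u≢v v≡u → u≢v (sym v≡u)
  ; irrefl = λ u≡v u≢v → u≢v u≡v
  }

module _ {V W : Set} (G : Graph V) (H : Graph W) where

  JoinAdj : Rel (V ⊎ W) 0ℓ
  JoinAdj (inj₁ u) (inj₁ v) = Adj G u v
  JoinAdj (inj₁ _) (inj₂ _) = ⊤
  JoinAdj (inj₂ _) (inj₁ _) = ⊤
  JoinAdj (inj₂ u) (inj₂ v) = Adj H u v

  join : Graph (V ⊎ W)
  join = record
    { Adj    = JoinAdj
    ; adj?   = dec
    ; symm   = λ {u} {v} → sy u v
    ; irrefl = λ {u} {v} → ir u v
    }
    where
    dec : Decidable JoinAdj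
    dec (inj₁ u) (inj₁ v) = adj? G u v
    dec (inj₁ _) (inj₂ _) = yes tt
    dec (inj₂ _) (inj₁ _) = yes tt
    dec (inj₂ u) (inj₂ v) = adj? H u v

    sy : ∀ u v → JoinAdj u v → JoinAdj v u
    sy (inj₁ _) (inj₁ _) = symm G
    sy (inj₁ _) (inj₂ _) = λ _ → tt
    sy (inj₂ _) (inj₁ _) = λ _ → tt
    sy (inj₂ _) (inj₂ _) = symm H

    ir : ∀ u v → u ≡ v → ¬ JoinAdj u v
    ir (inj₁ _) _ refl = irrefl G refl
    ir (inj₂ _) _ refl = irrefl H refl

module _ {k : ℕ} {V : Fin k → Set} (G : (i : Fin k) → Graph (V i)) where

  data ⨆Adj : Rel (Σ (Fin k) V) 0ℓ where
    within : ∀ {i u v} → Adj (G i) u v → ⨆Adj (i , u) (i , v)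

  ⨆ : Graph (Σ (Fin k) V)
  ⨆ = record
    { Adj    = ⨆Adj
    ; adj?   = dec
    ; symm   = sy
    ; irrefl = λ { refl (within e) → irrefl (G _) refl e }
    }
    where
    dec : Decidable ⨆Adj
    dec (i , u) (j , v) with i ≟ j
    ... | no i≢j = no λ { (within _) → i≢j refl }
    ... | yes refl with adj? (G i) u v
    ...   | yes e = yes (within e)
    ...   | no ¬e = no λ { (within e) → ¬e e }

    sy : Symmetric ⨆Adj
    sy (within e) = within (symm (G _) e)

deleteEdges : {V : Set} → Graph V → Graph V → Graph V
deleteEdges G M = record
  { Adj    = λ u v → Adj G u v × ¬ Adj M u v
  ; adj?   = λ u v → adj? G u v ×-dec ¬? (adj? M u v)
  ; symm   = λ (e , ¬m) → symm G e , ¬m ∘ symm M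
  ; irrefl = λ u≡v (e , _) → irrefl G u≡v e
  }

-- A set of edges M is given as the spanning graph with edge set M.
IsMatching : {V : Set} → Graph V → Set
IsMatching M = ∀ {u v w} → Adj M u v → Adj M u w → v ≡ w

IsNonEmpty : {V : Set} → Graph V → Set
IsNonEmpty M = ∃[ u ] ∃[ v ] Adj M u v

IsPerfect : {V : Set} → Graph V → Set
IsPerfect M = ∀ u → ∃[ v ] Adj M u v

Connected : {V : Set} → Graph V → Set
Connected G = ∀ u v → Star (Adj G) u v

-- A walk from u to v in G is an element of Star (Adj G) u v.
module _ {V : Set} {R : Rel V 0ℓ} where

  length : ∀ {u v} → Star R u v → ℕ
  length ε       = zero
  length (_ ◅ p) = suc (length p)

  vertices : ∀ {u v} → Star R u v → List V
  vertices {u} ε       = u ∷ []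
  vertices {u} (_ ◅ p) = u ∷ vertices p

  IsPath : ∀ {u v} → Star R u v → Set
  IsPath p = Unique (vertices p)

  IsGeodesic : ∀ {u v} → Star R u v → Set
  IsGeodesic {u} {v} p = IsPath p × (∀ (q : Star R u v) → IsPath q → length p ≤ length q)

IsMaximum IsMinimum : (ℕ → Set) → ℕ → Set
IsMaximum P k = P k × (∀ j → P j → j ≤ k)
IsMinimum P k = P k × (∀ j → P j → k ≤ j)

module _ {n : ℕ} (G : Graph (Fin n)) where

  IsPositionSet : Fin n → Subset n → Set
  IsPositionSet x S =
    ∀ y → y ∈ S → ∀ z → z ∈ S → z ≢ y →
    ∀ (p : Star (Adj G) x y) → IsGeodesic p → ¬ (z ∈ˡ vertices p)

  -- The numerical invariants are expressed as (functional) relations: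
  -- IsPositionNumber x k says that p_x(G) = k, IsVp k that vp(G) = k, and
  -- IsVp⁻ k that vp⁻(G) = k.
  IsPositionNumber : Fin n → ℕ → Set
  IsPositionNumber x = IsMaximum (λ j → ∃[ S ] (IsPositionSet x S × ∣ S ∣ ≡ j))

  IsVp : ℕ → Set
  IsVp = IsMaximum (λ j → ∃[ x ] IsPositionNumber x j)

  IsVp⁻ : ℕ → Set
  IsVp⁻ = IsMinimum (λ j → ∃[ x ] IsPositionNumber x j)

IsCliqueMinusMatching : {V : Set} → Graph V → Set₁
IsCliqueMinusMatching G =
  ∃[ m ] Σ[ M ∈ Graph (Fin m) ]
    IsMatching M × IsNonEmpty M × ¬ IsPerfect M × G ≅ deleteEdges (K m) M

-- A disjoint union of cliques is understood to have at least two, non-empty,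
-- members: with a single clique the join with K 1 would be complete, and a
-- complete graph has vp⁻ = n - 1.
IsK₁JoinCliques : {V : Set} → Graph V → Set
IsK₁JoinCliques G =
  ∃[ k ] Σ[ m ∈ (Fin k → ℕ) ]
    2 ≤ k × (∀ i → 1 ≤ m i) × G ≅ join (K 1) (⨆ λ i → K (m i))

-- A vertex x has p_x = n - 1 exactly when it is universal, so vp(G) = n - 1
-- provides a universal vertex u and all distances are at most 2.  An
-- x-position set contains at most one vertex of each induced path x, a, b.
-- Hence p_x ≥ n - 2 says that x has at most one non-neighbour or that every
-- induced path x, a, b has a = u.  If the first alternative holds at every x,
-- the complement of G is a matching; otherwise every induced path of length
-- two has centre u, so that G - u is a disjoint union of cliques.
module Submission where

open import Axiom.UniquenessOfIdentityProofs using (module Decidable⇒UIP)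
open import Data.Empty using (⊥; ⊥-elim)
open import Data.Fin using (Fin; zero; suc; punchIn; punchOut; fromℕ<)
open import Data.Fin.Properties
  using (_≟_; any?; ¬∀⟶∃¬; suc-injective; punchInᵢ≢i; punchIn-injective;
         punchIn-punchOut; punchOut-punchIn; punchOut-cong)
open import Data.Fin.Subset using (Subset; inside; outside; _∈_; _∉_; ∣_∣; ⊤; ∁; _-_)
import Data.Fin.Subset as Subset
open import Data.Fin.Subset.Properties
  using (_∈?_; ∣⊤∣≡n; ∣∁p∣≡n∸∣p∣; ∣p∣≤n; x∉p⇒x∈∁p; x∈p∧x≢y⇒x∈p-y; x∈p⇒∣p-x∣<∣p∣;
         p─q⊆p; p─⊥≡p; ∉⊥; ∣⊥∣≡0)
open import Data.List using ([]; _∷_)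
import Data.List as List
open import Data.List.Membership.Propositional using () renaming (_∈_ to _∈ˡ_)
open import Data.List.Relation.Unary.All as All using (All; []; _∷_)
open import Data.List.Relation.Unary.AllPairs using ([]; _∷_)
open import Data.List.Relation.Unary.Any using (here; there)
open import Data.List.Relation.Unary.Unique.Propositional using (Unique)
open import Data.Nat using (ℕ; zero; suc; _+_; _∸_; _≤_; z≤n; s≤s; s≤s⁻¹)
open import Data.Nat.Properties
  using (≤-reflexive; ≤-trans; ≤-antisym; ≮⇒≥; m∸n+n≡m; +-monoˡ-≤; +-monoʳ-≤; +-suc;
         +-identityʳ; 1+n≰n; n≤1+n; module ≤-Reasoning)
open import Data.Product using (Σ; Σ-syntax; ∃; ∃-syntax; _×_; _,_; proj₁; proj₂)
open import Data.Sum using (_⊎_; inj₁; inj₂)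
open import Data.Unit using (tt)
open import Data.Vec using (_∷_; here; there)
open import Function using (_∘_; _⇔_; _↔_; mk⇔; mk↔ₛ′; Inverse; Injection; Equivalence)
open import Function.Properties.Inverse using (↔-sym; ↔-refl; ↔⇒↣)
open import Level using (0ℓ)
open import Relation.Binary using (Rel; IsDecEquivalence)
import Relation.Binary.Construct.On as On
open import Relation.Binary.Construct.Closure.ReflexiveTransitive using (Star; ε; _◅_)
open import Relation.Binary.PropositionalEquality
  using (_≡_; _≢_; refl; sym; trans; cong; subst; subst₂; ≢-sym)
open import Relation.Nullary using (¬_; Dec; yes; no)
open import Relation.Nullary.Decidable using (decidable-stable; ¬?; _×-dec_; _⊎-dec_)
open import Relation.Unary using (Pred; Decidable; Irrelevant)
open import Defs

private
  variable
    n : ℕ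

-- Cardinalities of finite subsets.

length≤∣p∣ : ∀ (p : Subset n) {xs} → Unique xs → All (_∈ p) xs → List.length xs ≤ ∣ p ∣
length≤∣p∣ p [] [] = z≤n
length≤∣p∣ p (_∷_ {x = x} x∉xs xs!) (x∈p ∷ xs∈p) =
  ≤-trans (s≤s (length≤∣p∣ (p - x) xs! (All.zipWith restrict (x∉xs , xs∈p)))) (x∈p⇒∣p-x∣<∣p∣ x∈p)
  where
  restrict : ∀ {y} → x ≢ y × y ∈ p → y ∈ p - x
  restrict (x≢y , y∈p) = x∈p∧x≢y⇒x∈p-y y∈p (≢-sym x≢y)

-- The list `xs` fits into the complement of `p`. Every upper bound on a position set is obtained
-- this way, by exhibiting distinct vertices that it misses.
length+∣p∣≤n : ∀ (p : Subset n) {xs} → Unique xs → All (_∉ p) xs → List.length xs + ∣ p ∣ ≤ n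
length+∣p∣≤n {n} p {xs} xs! xs∉p = begin
  List.length xs + ∣ p ∣ ≤⟨ +-monoˡ-≤ ∣ p ∣ (length≤∣p∣ (∁ p) xs! (All.map x∉p⇒x∈∁p xs∉p)) ⟩
  ∣ ∁ p ∣ + ∣ p ∣        ≡⟨ cong (_+ ∣ p ∣) (∣∁p∣≡n∸∣p∣ p) ⟩
  (n ∸ ∣ p ∣) + ∣ p ∣    ≡⟨ m∸n+n≡m (∣p∣≤n p) ⟩
  n                      ∎
  where open ≤-Reasoning

∣p∣≤1+∣p-x∣ : ∀ (p : Subset n) x → ∣ p ∣ ≤ suc ∣ p - x ∣
∣p∣≤1+∣p-x∣ (inside ∷ p)  zero    = s≤s (≤-reflexive (cong ∣_∣ (sym (p─⊥≡p p))))
∣p∣≤1+∣p-x∣ (outside ∷ p) zero    = ≤-trans (≤-reflexive (cong ∣_∣ (sym (p─⊥≡p p)))) (n≤1+n _)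
∣p∣≤1+∣p-x∣ (inside ∷ p)  (suc x) = s≤s (∣p∣≤1+∣p-x∣ p x)
∣p∣≤1+∣p-x∣ (outside ∷ p) (suc x) = ∣p∣≤1+∣p-x∣ p x

x∈p-y⇒x≢y : ∀ (p : Subset n) {x y} → x ∈ p - y → x ≢ y
x∈p-y⇒x≢y (inside ∷ p)  (there x∈p) refl = x∈p-y⇒x≢y p x∈p refl
x∈p-y⇒x≢y (outside ∷ p) (there x∈p) refl = x∈p-y⇒x≢y p x∈p refl

x∈p-y⇒x∈p : ∀ (p : Subset n) {x y} → x ∈ p - y → x ∈ p
x∈p-y⇒x∈p p = p─q⊆p p _

-- Position numbers are only shown to exist up to double negation, as their
-- definition quantifies over all walks; this suffices because they are used
-- to prove equalities of vertices, which are decidable.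
¬¬-maximum : ∀ {P : ℕ → Set} d k → (∀ j → P j → j ≤ d + k) → P k → ¬ ¬ ∃ (IsMaximum P)
¬¬-maximum zero    k bound Pk ¬max = ¬max (k , Pk , bound)
¬¬-maximum (suc d) k bound Pk ¬max = ¬max (k , Pk , λ j Pj → ≮⇒≥ λ k<j →
  ¬¬-maximum d j (λ i Pi → begin
    i         ≤⟨ bound i Pi ⟩
    suc d + k ≡⟨ +-suc d k ⟨
    d + suc k ≤⟨ +-monoʳ-≤ d k<j ⟩
    d + j     ∎) Pj ¬max)
  where open ≤-Reasoning

missing₃-bound : ∀ (p : Subset n) {x y z} → x ∉ p → y ∉ p → z ∉ p →
                 x ≢ y → x ≢ z → y ≢ z → 3 + ∣ p ∣ ≤ n
missing₃-bound p x∉p y∉p z∉p x≢y x≢z y≢z =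
  length+∣p∣≤n p ((x≢y ∷ x≢z ∷ []) ∷ (y≢z ∷ []) ∷ [] ∷ []) (x∉p ∷ y∉p ∷ z∉p ∷ [])

-- Universal vertices and non-adjacency.

module _ {V : Set} (G : Graph V) where

  Universal : V → Set
  Universal u = ∀ v → u ≢ v → Adj G u v

  NonAdj : Rel V 0ℓ
  NonAdj u v = u ≢ v × ¬ Adj G u v

  NonAdj-sym : ∀ {u v} → NonAdj u v → NonAdj v u
  NonAdj-sym (u≢v , u≁v) = ≢-sym u≢v , u≁v ∘ symm G

  adj⇒≢ : ∀ {u v} → Adj G u v → u ≢ v
  adj⇒≢ e u≡v = irrefl G u≡v e

complement : Graph (Fin n) → Graph (Fin n)
complement G = record
  { Adj    = NonAdj G
  ; adj?   = λ u v → ¬? (u ≟ v) ×-dec ¬? (adj? G u v)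
  ; symm   = NonAdj-sym G
  ; irrefl = λ { u≡v (u≢v , _) → u≢v u≡v }
  }

-- Geodesics of length one and two.

module _ {V : Set} (G : Graph V) where

  edge-geodesic : ∀ {x y} (e : Adj G x y) → IsGeodesic {R = Adj G} (e ◅ ε)
  edge-geodesic e = ((adj⇒≢ G e ∷ []) ∷ [] ∷ []) , λ where
    ε       _ → ⊥-elim (irrefl G refl e)
    (_ ◅ _) _ → s≤s z≤n

  path₂-isPath : ∀ {x a b} (e : Adj G x a) (f : Adj G a b) → x ≢ b → IsPath {R = Adj G} (e ◅ f ◅ ε)
  path₂-isPath e f x≢b = (adj⇒≢ G e ∷ x≢b ∷ []) ∷ (adj⇒≢ G f ∷ []) ∷ [] ∷ []

  path₂-geodesic : ∀ {x a b} (e : Adj G x a) (f : Adj G a b) → NonAdj G x b →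
                   IsGeodesic {R = Adj G} (e ◅ f ◅ ε)
  path₂-geodesic e f (x≢b , x≁b) = path₂-isPath e f x≢b , λ where
    ε           _ → ⊥-elim (x≢b refl)
    (g ◅ ε)     _ → ⊥-elim (x≁b g)
    (_ ◅ _ ◅ _) _ → s≤s (s≤s z≤n)

  adj-geodesic-vertices : ∀ {x y z} → Adj G x y → (p : Star (Adj G) x y) → IsGeodesic p →
                          z ∈ˡ vertices p → z ≡ x ⊎ z ≡ y
  adj-geodesic-vertices e ε           _          (here z≡x)         = inj₁ z≡x
  adj-geodesic-vertices e (_ ◅ ε)     _          (here z≡x)         = inj₁ z≡x
  adj-geodesic-vertices e (_ ◅ ε)     _          (there (here z≡y)) = inj₂ z≡y
  adj-geodesic-vertices e (_ ◅ _ ◅ p) (_ , short) _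
    with s≤s () ← short (e ◅ ε) (proj₁ (edge-geodesic e))

  -- The given path through `u` only shows that the distance is two. A geodesic may run through any
  -- common neighbour of `x` and `y`, whence the last alternative.
  path₂-geodesic-vertices : ∀ {x u y z} → Adj G x u → Adj G u y → NonAdj G x y →
                            (p : Star (Adj G) x y) → IsGeodesic p → z ∈ˡ vertices p →
                            z ≡ x ⊎ z ≡ y ⊎ Adj G x z × Adj G z y
  path₂-geodesic-vertices e f (x≢y , x≁y) ε       _ _ = ⊥-elim (x≢y refl)
  path₂-geodesic-vertices e f (x≢y , x≁y) (g ◅ ε) _ _ = ⊥-elim (x≁y g)
  path₂-geodesic-vertices e f x≁y (g ◅ h ◅ ε) _ (here z≡x)                 = inj₁ z≡x
  path₂-geodesic-vertices e f x≁y (g ◅ h ◅ ε) _ (there (here refl))        = inj₂ (inj₂ (g , h))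
  path₂-geodesic-vertices e f x≁y (g ◅ h ◅ ε) _ (there (there (here z≡y))) = inj₂ (inj₁ z≡y)
  path₂-geodesic-vertices e f (x≢y , _) (_ ◅ _ ◅ _ ◅ _) (_ , short) _
    with s≤s (s≤s ()) ← short (e ◅ f ◅ ε) (path₂-isPath e f x≢y)

-- Upper bounds on position sets.

module _ (G : Graph (Fin n)) where

  adj-nonAdj⇒≢ : ∀ {x v w} → Adj G x v → NonAdj G x w → v ≢ w
  adj-nonAdj⇒≢ x~v (_ , x≁w) refl = x≁w x~v

  -- A walk from `x` to `y` starts in the closed neighbourhood of `x` and ends outside it; its first
  -- step out of this neighbourhood goes from `a` to `b`.
  connected⇒inducedPath₂ : Connected G → ∀ {x y} → NonAdj G x y →
                           ∃[ a ] ∃[ b ] (Adj G x a × Adj G a b × NonAdj G x b)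
  connected⇒inducedPath₂ conn {x} {y} (x≢y , x≁y) = go (inj₁ refl) (conn x y)
    where
    go : ∀ {v} → x ≡ v ⊎ Adj G x v → Star (Adj G) v y →
         ∃[ a ] ∃[ b ] (Adj G x a × Adj G a b × NonAdj G x b)
    go (inj₁ refl) ε       = ⊥-elim (x≢y refl)
    go (inj₁ refl) (e ◅ p) = go (inj₂ e) p
    go (inj₂ e)    ε       = ⊥-elim (x≁y e)
    go (inj₂ e) (_◅_ {j = b} f p) with x ≟ b | adj? G x b
    ... | yes x≡b | _       = go (inj₁ x≡b) p
    ... | no _    | yes x~b = go (inj₂ x~b) p
    ... | no x≢b  | no x≁b  = _ , b , e , f , x≢b , x≁b

  module _ {x : Fin n} {S : Subset n} (pos : IsPositionSet G x S) where

    -- Every geodesic from `x` contains `x` itself, so a position set with `x` in it has no other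
    -- vertex that a geodesic reaches.
    source∉ : ∀ {a} → Adj G x a → x ∈ S → a ∉ S
    source∉ e x∈S a∈S =
      pos _ a∈S _ x∈S (adj⇒≢ G e) (e ◅ ε) (edge-geodesic G e) (here refl)

    module _ {a b} (e : Adj G x a) (f : Adj G a b) (x≁b : NonAdj G x b) where

      source∈⇒end∉ : x ∈ S → b ∉ S
      source∈⇒end∉ x∈S b∈S =
        pos _ b∈S _ x∈S (proj₁ x≁b) (e ◅ f ◅ ε) (path₂-geodesic G e f x≁b) (here refl)

      centre∈⇒end∉ : a ∈ S → b ∉ S
      centre∈⇒end∉ a∈S b∈S =
        pos _ b∈S _ a∈S (adj⇒≢ G f) (e ◅ f ◅ ε) (path₂-geodesic G e f x≁b) (there (here refl))

      inducedPath₂-bound : 2 + ∣ S ∣ ≤ n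
      inducedPath₂-bound with x ∈? S | a ∈? S
      ... | yes x∈S | _ = length+∣p∣≤n S {a ∷ b ∷ []} ((adj⇒≢ G f ∷ []) ∷ [] ∷ [])
                            (source∉ e x∈S ∷ source∈⇒end∉ x∈S ∷ [])
      ... | no x∉S | yes a∈S = length+∣p∣≤n S {x ∷ b ∷ []} ((proj₁ x≁b ∷ []) ∷ [] ∷ [])
                            (x∉S ∷ centre∈⇒end∉ a∈S ∷ [])
      ... | no x∉S | no a∉S = length+∣p∣≤n S {x ∷ a ∷ []} ((adj⇒≢ G e ∷ []) ∷ [] ∷ []) (x∉S ∷ a∉S ∷ [])

    edge-bound : ∀ {a} → Adj G x a → 1 + ∣ S ∣ ≤ n
    edge-bound {a} e with x ∈? S
    ... | yes x∈S = length+∣p∣≤n S {a ∷ []} ([] ∷ []) (source∉ e x∈S ∷ [])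
    ... | no x∉S  = length+∣p∣≤n S {x ∷ []} ([] ∷ []) (x∉S ∷ [])

    -- The two paths meet only in `x`, since neighbours of `x` differ from non-neighbours. If `x` is
    -- outside `S`, one of `a`, `b` and one of `u`, `y` are missing as well; if `x` is in `S`, then
    -- `a`, `u` and `b` are missing.
    twoInducedPaths-bound : ∀ {a b u y} → Adj G x a → Adj G a b → NonAdj G x b →
                            Adj G x u → Adj G u y → NonAdj G x y →
                            a ≢ u → b ≢ y → 3 + ∣ S ∣ ≤ n
    twoInducedPaths-bound {a} {b} {u} {y} x~a a~b x≁b x~u u~y x≁y a≢u b≢y
      with x ∈? S | a ∈? S | u ∈? S
    ... | yes x∈S | _ | _ =
      missing₃-bound S (source∉ x~a x∈S) (source∉ x~u x∈S) (source∈⇒end∉ x~a a~b x≁b x∈S)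
        a≢u (adj⇒≢ G a~b) (adj-nonAdj⇒≢ x~u x≁b)
    ... | no x∉S | yes a∈S | yes u∈S =
      missing₃-bound S x∉S (centre∈⇒end∉ x~a a~b x≁b a∈S) (centre∈⇒end∉ x~u u~y x≁y u∈S)
        (proj₁ x≁b) (proj₁ x≁y) b≢y
    ... | no x∉S | yes a∈S | no u∉S =
      missing₃-bound S x∉S (centre∈⇒end∉ x~a a~b x≁b a∈S) u∉S
        (proj₁ x≁b) (adj⇒≢ G x~u) (≢-sym (adj-nonAdj⇒≢ x~u x≁b))
    ... | no x∉S | no a∉S | yes u∈S =
      missing₃-bound S x∉S a∉S (centre∈⇒end∉ x~u u~y x≁y u∈S)
        (adj⇒≢ G x~a) (proj₁ x≁y) (adj-nonAdj⇒≢ x~a x≁y)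
    ... | no x∉S | no a∉S | no u∉S =
      missing₃-bound S x∉S a∉S u∉S (adj⇒≢ G x~a) (adj⇒≢ G x~u) a≢u

  -- Construction of large position sets.

  -- Deleting `c` can destroy an induced path from `x` either at its end or at its middle. Allowing
  -- both roles treats a vertex with a single non-neighbour and a vertex whose induced paths share
  -- their middle at once.
  Shielded : Fin n → Fin n → Set
  Shielded x c = ∀ {a b} → Adj G x a → Adj G a b → NonAdj G x b → b ≢ c → a ≡ c

  module _ {u} (univ : Universal G u) where

    universal-common : ∀ {x y} → NonAdj G x y → Adj G x u × Adj G u y
    universal-common {x} {y} (x≢y , x≁y) = symm G (univ x u≢x) , univ y u≢y
      where
      u≢x : u ≢ x
      u≢x refl = x≁y (univ y x≢y)
      u≢y : u ≢ y
      u≢y refl = x≁y (symm G (univ x (≢-sym x≢y)))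

    -- The universal vertex keeps geodesics at length at most two, so a violation would be an
    -- induced path `x`, `z`, `y` with neither `z` nor `y` equal to `c`.
    shielded⇒positionSet : ∀ {x c} → Shielded x c → IsPositionSet G x (⊤ - x - c)
    shielded⇒positionSet {x} {c} sh y y∈S z z∈S z≢y p geo z∈p with adj? G x y
    ... | yes x~y with adj-geodesic-vertices G x~y p geo z∈p
    ...   | inj₁ z≡x = z≢x z≡x
      where z≢x = x∈p-y⇒x≢y ⊤ (x∈p-y⇒x∈p (⊤ - x) z∈S)
    ...   | inj₂ z≡y = z≢y z≡y
    shielded⇒positionSet {x} {c} sh y y∈S z z∈S z≢y p geo z∈p | no x≁y = conclude
      (path₂-geodesic-vertices G (proj₁ (universal-common nonadj)) (proj₂ (universal-common nonadj))
        nonadj p geo z∈p)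
      where
      y≢x = x∈p-y⇒x≢y ⊤ (x∈p-y⇒x∈p (⊤ - x) y∈S)
      z≢x = x∈p-y⇒x≢y ⊤ (x∈p-y⇒x∈p (⊤ - x) z∈S)
      nonadj : NonAdj G x y
      nonadj = ≢-sym y≢x , x≁y
      conclude : z ≡ x ⊎ z ≡ y ⊎ Adj G x z × Adj G z y → ⊥
      conclude (inj₁ z≡x)               = z≢x z≡x
      conclude (inj₂ (inj₁ z≡y))        = z≢y z≡y
      conclude (inj₂ (inj₂ (x~z , z~y))) =
        x∈p-y⇒x≢y (⊤ - x) z∈S (sh x~z z~y nonadj (x∈p-y⇒x≢y (⊤ - x) y∈S))

  universal⇒positionSet : ∀ {x} → Universal G x → IsPositionSet G x (⊤ - x)
  universal⇒positionSet {x} univ y y∈S z z∈S z≢y p geo z∈p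
    with adj-geodesic-vertices G (univ y (≢-sym (x∈p-y⇒x≢y ⊤ y∈S))) p geo z∈p
  ... | inj₁ z≡x = x∈p-y⇒x≢y ⊤ z∈S z≡x
  ... | inj₂ z≡y = z≢y z≡y

n≤1+∣⊤-x∣ : ∀ (x : Fin n) → n ≤ 1 + ∣ ⊤ - x ∣
n≤1+∣⊤-x∣ {n} x = subst (_≤ 1 + ∣ ⊤ - x ∣) (∣⊤∣≡n n) (∣p∣≤1+∣p-x∣ ⊤ x)

n≤2+∣⊤-x-y∣ : ∀ (x y : Fin n) → n ≤ 2 + ∣ ⊤ - x - y ∣
n≤2+∣⊤-x-y∣ x y = ≤-trans (n≤1+∣⊤-x∣ x) (s≤s (∣p∣≤1+∣p-x∣ (⊤ - x) y))

-- Given the universal vertex, the field forced expresses that p_x ≥ n - 2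
-- for every vertex x.
record Core {V : Set} (G : Graph V) : Set where
  field
    centre     : V
    universal  : Universal G centre
    left right : V
    nonAdj     : NonAdj G left right
    forced     : ∀ {x y z a b} → NonAdj G x y → NonAdj G x z → y ≢ z →
                 Adj G x a → Adj G a b → NonAdj G x b → a ≡ centre

-- Equivalence of the numerical conditions with `Core`.

twoNonNeighbours? : ∀ (G : Graph (Fin n)) x → Dec (∃[ y ] ∃[ z ] (NonAdj G x y × NonAdj G x z × y ≢ z))
twoNonNeighbours? G x = any? λ y → any? λ z →
  adj? (complement G) x y ×-dec adj? (complement G) x z ×-dec ¬? (y ≟ z)

module _ (G : Graph (Fin (2 + n))) where

  positionNumber-max : ∀ {x k S} → IsPositionNumber G x k → IsPositionSet G x S → ∣ S ∣ ≤ k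
  positionNumber-max (_ , max) pos = max _ (_ , pos , refl)

  isPositionNumber : ∀ {x k S} → IsPositionSet G x S → k ≤ ∣ S ∣ →
                     (∀ {T} → IsPositionSet G x T → ∣ T ∣ ≤ k) → IsPositionNumber G x k
  isPositionNumber pos k≤∣S∣ bound =
    (_ , pos , ≤-antisym (bound pos) k≤∣S∣) , λ { j (T , T-pos , refl) → bound T-pos }

  -- The minimum constrains only vertices that have a position number, and the existence of that
  -- number is available only under double negation.
  vp⁻⇒large : ∀ {k} → IsVp⁻ G k → ∀ x → ¬ ¬ (∃[ S ] (IsPositionSet G x S × k ≤ ∣ S ∣))
  vp⁻⇒large (_ , min) x ¬large =
    -- The search starts from the empty set, of size `0`, and no subset exceeds `2 + n`.
    ¬¬-maximum {λ j → ∃[ S ] (IsPositionSet G x S × ∣ S ∣ ≡ j)} (2 + n) 0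
      (λ { _ (S , _ , refl) → subst (∣ S ∣ ≤_) (sym (+-identityʳ _)) (∣p∣≤n S) })
      (Subset.⊥ , (λ _ y∈⊥ → ⊥-elim (∉⊥ y∈⊥)) , ∣⊥∣≡0 (2 + n))
      λ { (k , number@((S , pos , refl) , _)) → ¬large (S , pos , min _ (x , number)) }

  -- With order `2 + n` the two values are `n` and `1 + n`, free of subtraction. A vertex attaining
  -- the maximum becomes the centre; a vertex attaining the minimum cannot be universal and gives
  -- the non-adjacent pair.
  vp⇒core : Connected G → IsVp⁻ G n → IsVp G (1 + n) → Core G
  vp⇒core conn vp⁻@((x₀ , p₀) , _) ((u , (S , S-pos , ∣S∣≡1+n) , _) , _) = record
    { centre    = u
    ; universal = univ
    ; left      = proj₁ nonAdj
    ; right     = proj₁ (proj₂ nonAdj)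
    ; nonAdj    = proj₂ (proj₂ nonAdj)
    ; forced    = forced
    }
    where
    univ : Universal G u
    univ v u≢v with adj? G u v
    ... | yes u~v = u~v
    -- An induced path from `u` would cost `S` two vertices, but `S` misses only one.
    ... | no u≁v with connected⇒inducedPath₂ G conn (u≢v , u≁v)
    ...   | _ , _ , e , f , u≁b =
      ⊥-elim (1+n≰n (subst (λ k → 2 + k ≤ 2 + n) ∣S∣≡1+n (inducedPath₂-bound G S-pos e f u≁b)))

    nonAdj : ∃[ x ] ∃[ y ] NonAdj G x y
    nonAdj with any? (adj? (complement G) x₀)
    ... | yes (y , x≁y) = x₀ , y , x≁y
    -- If `x₀` were universal, all other vertices would form a position set of size `1 + n`.
    ... | no none = ⊥-elim (1+n≰n (≤-trans (s≤s⁻¹ (n≤1+∣⊤-x∣ x₀))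
            (positionNumber-max p₀ (universal⇒positionSet G λ v x≢v →
              decidable-stable (adj? G x₀ v) λ x≁v → none (v , x≢v , x≁v)))))

    forced : ∀ {x y z a b} → NonAdj G x y → NonAdj G x z → y ≢ z →
             Adj G x a → Adj G a b → NonAdj G x b → a ≡ u
    forced {x} {y} {z} {a} {b} x≁y x≁z y≢z x~a a~b x≁b =
      -- As `y` and `z` differ, `b` differs from one of them. The path through `u` to that one,
      -- together with `x`, `a`, `b`, would cost `T` three vertices, while `T` misses at most two.
      decidable-stable (a ≟ u) λ a≢u → vp⁻⇒large vp⁻ x λ { (T , T-pos , n≤∣T∣) →
        let tooSmall : ∀ {w} → NonAdj G x w → b ≢ w → ⊥
            tooSmall x≁w b≢w = 1+n≰n (≤-trans (s≤s n≤∣T∣) (s≤s⁻¹ (s≤s⁻¹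
              (twoInducedPaths-bound G T-pos x~a a~b x≁b
                (proj₁ (universal-common G univ x≁w)) (proj₂ (universal-common G univ x≁w))
                x≁w a≢u b≢w))))
        in tooSmall x≁y λ { refl → tooSmall x≁z y≢z } }

  -- Shielding gives every vertex a position set of size at least `n`. The induced path `left`,
  -- `centre`, `right` shows that `left` attains this value, and `centre` attains the maximum
  -- because it is universal.
  core⇒vp : Core G → IsVp⁻ G n × IsVp G (1 + n)
  core⇒vp core =
    ((left , isPositionNumber (shielded-pos left) (large left)
        (λ pos → s≤s⁻¹ (s≤s⁻¹ (inducedPath₂-bound G pos left~centre centre~right nonAdj)))) ,
      λ { j (x , number) → ≤-trans (large x) (positionNumber-max number (shielded-pos x)) }) ,
    ((centre , isPositionNumber (universal⇒positionSet G universal)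
        (s≤s⁻¹ (n≤1+∣⊤-x∣ centre)) small) ,
      λ { j (x , (S , pos , refl) , _) → small pos })
    where
    open Core core

    left~centre : Adj G left centre
    left~centre = proj₁ (universal-common G universal nonAdj)

    centre~right : Adj G centre right
    centre~right = proj₂ (universal-common G universal nonAdj)

    -- The second vertex to delete is the centre if `x` has two non-neighbours, and otherwise its
    -- only non-neighbour. If there is none, no induced path of length two starts at `x`, and `x`
    -- itself is a dummy value.
    shielded : ∀ x → ∃ (Shielded G x)
    shielded x with twoNonNeighbours? G x
    ... | yes (y , z , x≁y , x≁z , y≢z) =
      centre , λ x~a a~b x≁b _ → forced x≁y x≁z y≢z x~a a~b x≁b
    ... | no ¬two with any? (adj? (complement G) x)
    ...   | yes (y , x≁y) = y , λ {_} {b} _ _ x≁b b≢y → ⊥-elim (¬two (b , y , x≁b , x≁y , b≢y))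
    ...   | no none       = x , λ {_} {b} _ _ x≁b _ → ⊥-elim (none (b , x≁b))

    shielded-pos : ∀ x → IsPositionSet G x (⊤ - x - proj₁ (shielded x))
    shielded-pos x = shielded⇒positionSet G universal (proj₂ (shielded x))

    large : ∀ x → n ≤ ∣ ⊤ - x - proj₁ (shielded x) ∣
    large x = s≤s⁻¹ (s≤s⁻¹ (n≤2+∣⊤-x-y∣ x (proj₁ (shielded x))))

    small : ∀ {x S} → IsPositionSet G x S → ∣ S ∣ ≤ 1 + n
    -- No vertex is isolated: the centre has the neighbour `left`, any other vertex has the centre.
    small {x} pos with x ≟ centre
    ... | yes refl     = s≤s⁻¹ (edge-bound G pos (symm G left~centre))
    ... | no x≢centre  = s≤s⁻¹ (edge-bound G pos (symm G (universal x (≢-sym x≢centre))))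

-- Transport along isomorphisms.

module _ {V W : Set} {G : Graph V} {H : Graph W} where

  ≅-sym : G ≅ H → H ≅ G
  ≅-sym (f , adj) = ↔-sym f , λ u v → mk⇔
    (λ e → Equivalence.from (adj (from u) (from v))
             (subst₂ (Adj H) (sym (strictlyInverseˡ u)) (sym (strictlyInverseˡ v)) e))
    (λ e → subst₂ (Adj H) (strictlyInverseˡ u) (strictlyInverseˡ v)
             (Equivalence.to (adj (from u) (from v)) e))
    where open Inverse f

  NonAdj-≅ : ((f , _) : G ≅ H) → ∀ {u v} → NonAdj G u v → NonAdj H (Inverse.to f u) (Inverse.to f v)
  NonAdj-≅ (f , adj) (u≢v , u≁v) =
    u≢v ∘ Injection.injective (↔⇒↣ f) , u≁v ∘ Equivalence.from (adj _ _)

-- `Core` makes sense over any vertex type, so it can be checked on the model graphs themselves,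
-- whereas position numbers are defined only over `Fin n`.
core-≅ : ∀ {V W : Set} {G : Graph V} {H : Graph W} → G ≅ H → Core H → Core G
core-≅ {G = G} {H} G≅H@(f , adj) core = record
  { centre    = from centre
  ; universal = λ v c≢v → Equivalence.from (adj (from centre) v)
      (subst (λ c → Adj H c (to v)) (sym (strictlyInverseˡ centre))
        (universal (to v) λ { refl → c≢v (strictlyInverseʳ v) }))
  ; left      = from left
  ; right     = from right
  ; nonAdj    = NonAdj-≅ {G = H} {G} (≅-sym {G = G} {H} G≅H) nonAdj
  ; forced    = λ {x} {y} {z} {a} {b} x≁y x≁z y≢z x~a a~b x≁b →
      trans (sym (strictlyInverseʳ a)) (cong from (forced
        (NonAdj-≅ {G = G} {H} G≅H x≁y) (NonAdj-≅ {G = G} {H} G≅H x≁z)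
        (y≢z ∘ Injection.injective (↔⇒↣ f))
        (Equivalence.to (adj x a) x~a) (Equivalence.to (adj a b) a~b)
        (NonAdj-≅ {G = G} {H} G≅H x≁b)))
  }
  where
  open Inverse f
  open Core core

-- The two families satisfy `Core`.

-- A vertex that the matching leaves uncovered is universal. The field `forced` holds vacuously,
-- since in a matching no vertex has two partners.
cliqueMinusMatching-core : ∀ {m} (M : Graph (Fin m)) → IsMatching M → IsNonEmpty M → ¬ IsPerfect M →
                           Core (deleteEdges (K m) M)
cliqueMinusMatching-core {m} M matching (l , r , edge) ¬perfect
  with w , isolated ← ¬∀⟶∃¬ m (λ u → ∃ (Adj M u)) (λ u → any? (adj? M u)) ¬perfect = record
  { centre    = w
  ; universal = λ v w≢v → w≢v , λ e → isolated (v , e)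
  ; left      = l
  ; right     = r
  ; nonAdj    = (λ l≡r → irrefl M l≡r edge) , λ { (_ , ¬edge) → ¬edge edge }
  ; forced    = λ x≁y x≁z y≢z _ _ _ → ⊥-elim (y≢z (matching (matched x≁y) (matched x≁z)))
  }
  where
  matched : ∀ {u v} → NonAdj (deleteEdges (K m) M) u v → Adj M u v
  matched (u≢v , u≁v) = decidable-stable (adj? M _ _) λ ¬e → u≁v (u≢v , ¬e)

module _ {k} (m : Fin k → ℕ) where

  K₁JoinCliques : Graph (Fin 1 ⊎ Σ (Fin k) (Fin ∘ m))
  K₁JoinCliques = join (K 1) (⨆ λ i → K (m i))

  -- Non-adjacent vertices must come from different cliques.
  nonAdj⇒2≤k : ∀ s t → NonAdj K₁JoinCliques s t → 2 ≤ k
  nonAdj⇒2≤k (inj₁ zero) (inj₁ zero) (s≢t , _) = ⊥-elim (s≢t refl)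
  nonAdj⇒2≤k (inj₁ _)    (inj₂ _)    (_ , s≁t) = ⊥-elim (s≁t tt)
  nonAdj⇒2≤k (inj₂ _)    (inj₁ _)    (_ , s≁t) = ⊥-elim (s≁t tt)
  nonAdj⇒2≤k (inj₂ (i , a)) (inj₂ (j , b)) (s≢t , s≁t) = ≢⇒2≤k i j λ { refl →
    s≁t (within λ { refl → s≢t refl }) }
    where
    ≢⇒2≤k : ∀ {k} (i j : Fin k) → i ≢ j → 2 ≤ k
    ≢⇒2≤k {1}           zero zero i≢j = ⊥-elim (i≢j refl)
    ≢⇒2≤k {suc (suc _)} _    _    _   = s≤s (s≤s z≤n)

  -- The vertex of `K 1` is universal and so ends no induced path of length two; a path avoiding it
  -- stays within one clique.
  inducedPath₂-centre : ∀ {s t r} → Adj K₁JoinCliques s t → Adj K₁JoinCliques t r →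
                        NonAdj K₁JoinCliques s r → t ≡ inj₁ zero
  inducedPath₂-centre {t = inj₁ zero} _ _ _ = refl
  inducedPath₂-centre {inj₁ zero} {inj₂ _} {inj₁ zero} _ _ (s≢r , _) = ⊥-elim (s≢r refl)
  inducedPath₂-centre {inj₁ _} {inj₂ _} {inj₂ _} _ _ (_ , s≁r) = ⊥-elim (s≁r tt)
  inducedPath₂-centre {inj₂ _} {inj₂ _} {inj₁ _} _ _ (_ , s≁r) = ⊥-elim (s≁r tt)
  inducedPath₂-centre {inj₂ _} {inj₂ _} {inj₂ _} (within _) (within _) (s≢r , s≁r) =
    ⊥-elim (s≁r (within λ { refl → s≢r refl }))

K₁JoinCliques-core : ∀ {k} (m : Fin k → ℕ) → 2 ≤ k → (∀ i → 1 ≤ m i) → Core (K₁JoinCliques m)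
K₁JoinCliques-core {suc (suc _)} m (s≤s (s≤s _)) nonEmpty = record
  { centre    = inj₁ zero
  ; universal = λ { (inj₁ zero) c≢v → ⊥-elim (c≢v refl) ; (inj₂ _) _ → tt }
  ; left      = inj₂ (zero , fromℕ< (nonEmpty zero))
  ; right     = inj₂ (suc zero , fromℕ< (nonEmpty (suc zero)))
  ; nonAdj    = (λ ()) , λ ()
  ; forced    = λ _ _ _ x~a a~b x≁b → inducedPath₂-centre m x~a a~b x≁b
  }

-- Graphs with transitive adjacency as disjoint unions of cliques.

-- Irrelevance gives `∃ P` exactly one element for each index satisfying `P`, so that counting those
-- indices yields a bijection.
enumerate : ∀ {P : Pred (Fin n) 0ℓ} → Decidable P → Irrelevant P → ∃[ m ] (Fin m ↔ ∃ P)
enumerate {zero} P? irr = 0 , mk↔ₛ′ (λ ()) (λ { (() , _) }) (λ { (() , _) }) (λ ())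
enumerate {suc n} {P} P? irr with P? zero | enumerate {n} {P ∘ suc} (P? ∘ suc) irr
... | yes p₀ | m , e = suc m , mk↔ₛ′ to′ from′ to∘from from∘to
  where
  open Inverse e
  to′ : Fin (suc m) → ∃ P
  to′ zero    = zero , p₀
  to′ (suc i) = suc (proj₁ (to i)) , proj₂ (to i)
  from′ : ∃ P → Fin (suc m)
  from′ (zero  , _) = zero
  from′ (suc v , p) = suc (from (v , p))
  to∘from : ∀ vp → to′ (from′ vp) ≡ vp
  to∘from (zero  , p) = cong (zero ,_) (irr p₀ p)
  to∘from (suc v , p) = cong (λ (v , p) → suc v , p) (strictlyInverseˡ (v , p))
  from∘to : ∀ i → from′ (to′ i) ≡ i
  from∘to zero    = refl
  from∘to (suc i) = cong suc (strictlyInverseʳ i)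
... | no ¬p₀ | m , e = m , mk↔ₛ′ to′ from′ to∘from strictlyInverseʳ
  where
  open Inverse e
  to′ : Fin m → ∃ P
  to′ i = suc (proj₁ (to i)) , proj₂ (to i)
  from′ : ∃ P → Fin m
  from′ (zero  , p) = ⊥-elim (¬p₀ p)
  from′ (suc v , p) = from (v , p)
  to∘from : ∀ vp → to′ (from′ vp) ≡ vp
  to∘from (zero  , p) = ⊥-elim (¬p₀ p)
  to∘from (suc v , p) = cong (λ (v , p) → suc v , p) (strictlyInverseˡ (v , p))

module _ {k} (c : Fin n → Fin k) where

  fibre : ∀ i → ∃[ m ] (Fin m ↔ (∃[ v ] c v ≡ i))
  fibre i = enumerate (λ v → c v ≟ i) (Decidable⇒UIP.≡-irrelevant _≟_)

  fibreSize : Fin k → ℕ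
  fibreSize i = proj₁ (fibre i)

  module Fibre i = Inverse (proj₂ (fibre i))

  fibres : Σ (Fin k) (Fin ∘ fibreSize) ↔ Fin n
  fibres = mk↔ₛ′ (λ (i , a) → proj₁ (Fibre.to i a)) (λ v → c v , Fibre.from (c v) (v , refl))
    (λ v → cong proj₁ (Fibre.strictlyInverseˡ (c v) (v , refl)))
    (λ (i , a) → unique a (Fibre.to i a) refl)
    where
    -- Replacing `Fibre.to i a` by a variable `w` makes it possible to match its equation with
    -- `refl`, which identifies `i` with the class of the vertex.
    unique : ∀ {i} (a : Fin (fibreSize i)) (w : ∃[ v ] c v ≡ i) → Fibre.to i a ≡ w →
             (c (proj₁ w) , Fibre.from (c (proj₁ w)) (proj₁ w , refl)) ≡ (i , a)
    unique {i} a (v , refl) eq =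
      cong (i ,_) (trans (cong (Fibre.from i) (sym eq)) (Fibre.strictlyInverseʳ i a))

  fibres-class : ∀ i a → c (Inverse.to fibres (i , a)) ≡ i
  fibres-class i a = proj₂ (Fibre.to i a)

-- Classes are numbered by induction on `n`: `zero` joins the class of an equivalent later vertex,
-- or opens a new class if there is none. Surjectivity will make every clique non-empty.
classify : ∀ {_≈_ : Rel (Fin n) 0ℓ} → IsDecEquivalence _≈_ →
           ∃[ k ] Σ[ c ∈ (Fin n → Fin k) ] (∀ i → ∃[ v ] c v ≡ i) × (∀ u v → u ≈ v ⇔ c u ≡ c v)
classify {zero} _ = 0 , (λ ()) , (λ ()) , λ ()
classify {suc n} {_≈_} equiv
  with any? (λ v → IsDecEquivalence._≟_ equiv zero (suc v))
     | classify {n} (On.isDecEquivalence suc equiv)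
... | yes (v₀ , 0≈v₀) | k , c , surj , classes = k , c′ , surj′ , classes′
  where
  open IsDecEquivalence equiv using () renaming (refl to ≈-refl; sym to ≈-sym; trans to ≈-trans)
  c′ : Fin (suc n) → Fin k
  c′ zero    = c v₀
  c′ (suc v) = c v
  surj′ : ∀ i → ∃[ v ] c′ v ≡ i
  surj′ i with v , cv≡i ← surj i = suc v , cv≡i
  classes′ : ∀ u v → u ≈ v ⇔ c′ u ≡ c′ v
  classes′ zero    zero    = mk⇔ (λ _ → refl) (λ _ → ≈-refl)
  classes′ zero    (suc v) = mk⇔
    (λ 0≈v → Equivalence.to (classes v₀ v) (≈-trans (≈-sym 0≈v₀) 0≈v))
    (λ eq → ≈-trans 0≈v₀ (Equivalence.from (classes v₀ v) eq))
  classes′ (suc u) zero    = mk⇔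
    (λ u≈0 → Equivalence.to (classes u v₀) (≈-trans u≈0 0≈v₀))
    (λ eq → ≈-trans (Equivalence.from (classes u v₀) eq) (≈-sym 0≈v₀))
  classes′ (suc u) (suc v) = classes u v
... | no none | k , c , surj , classes = suc k , c′ , surj′ , classes′
  where
  open IsDecEquivalence equiv using () renaming (refl to ≈-refl; sym to ≈-sym)
  c′ : Fin (suc n) → Fin (suc k)
  c′ zero    = zero
  c′ (suc v) = suc (c v)
  surj′ : ∀ i → ∃[ v ] c′ v ≡ i
  surj′ zero    = zero , refl
  surj′ (suc i) with v , cv≡i ← surj i = suc v , cong suc cv≡i
  classes′ : ∀ u v → u ≈ v ⇔ c′ u ≡ c′ v
  classes′ zero    zero    = mk⇔ (λ _ → refl) (λ _ → ≈-refl)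
  classes′ zero    (suc v) = mk⇔ (λ 0≈v → ⊥-elim (none (v , 0≈v))) λ ()
  classes′ (suc u) zero    = mk⇔ (λ u≈0 → ⊥-elim (none (u , ≈-sym u≈0))) λ ()
  classes′ (suc u) (suc v) = mk⇔
    (λ u≈v → cong suc (Equivalence.to (classes u v) u≈v))
    (λ eq → Equivalence.from (classes u v) (suc-injective eq))

-- The hypothesis makes "equal or adjacent" an equivalence relation, and its classes are the
-- cliques.
cluster⇒cliques : ∀ (H : Graph (Fin n)) →
                  (∀ {a b c} → Adj H a b → Adj H b c → a ≢ c → Adj H a c) →
                  ∃[ k ] Σ[ m ∈ (Fin k → ℕ) ] (∀ i → 1 ≤ m i) × (⨆ λ i → K (m i)) ≅ H
cluster⇒cliques {n} H cluster =
  k , fibreSize c , nonEmpty , fibres c , λ s t → mk⇔ (⇒ s t) (⇐ s t)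
  where
  _≈_ : Rel (Fin n) 0ℓ
  u ≈ v = u ≡ v ⊎ Adj H u v
  ≈-trans : ∀ {a b c} → a ≈ b → b ≈ c → a ≈ c
  ≈-trans (inj₁ refl) b≈c         = b≈c
  ≈-trans (inj₂ a~b)  (inj₁ refl) = inj₂ a~b
  ≈-trans {a} {b} {c} (inj₂ a~b) (inj₂ b~c) with a ≟ c
  ... | yes a≡c = inj₁ a≡c
  ... | no a≢c  = inj₂ (cluster a~b b~c a≢c)
  equiv : IsDecEquivalence _≈_
  equiv = record
    { isEquivalence = record
      { refl  = inj₁ refl
      ; sym   = λ { (inj₁ eq) → inj₁ (sym eq) ; (inj₂ e) → inj₂ (symm H e) }
      ; trans = ≈-trans
      }
    ; _≟_ = λ u v → (u ≟ v) ⊎-dec adj? H u v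
    }

  classification = classify equiv
  k       = proj₁ classification
  c       = proj₁ (proj₂ classification)
  surj    = proj₁ (proj₂ (proj₂ classification))
  classes = proj₂ (proj₂ (proj₂ classification))

  open Inverse (fibres c) using (to)

  nonEmpty : ∀ i → 1 ≤ fibreSize c i
  nonEmpty i = inhabited (Fibre.from c i (surj i))
    where
    inhabited : ∀ {m} → Fin m → 1 ≤ m
    inhabited zero    = s≤s z≤n
    inhabited (suc _) = s≤s z≤n

  ⇒ : ∀ s t → Adj (⨆ λ i → K (fibreSize c i)) s t → Adj H (to s) (to t)
  ⇒ (i , a) (.i , b) (within a≢b)
    with Equivalence.from (classes (to (i , a)) (to (i , b)))
           (trans (fibres-class c i a) (sym (fibres-class c i b)))
  ... | inj₁ eq with refl ← Injection.injective (↔⇒↣ (fibres c)) eq = ⊥-elim (a≢b refl)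
  ... | inj₂ e = e

  ⇐ : ∀ s t → Adj H (to s) (to t) → Adj (⨆ λ i → K (fibreSize c i)) s t
  ⇐ (i , a) (j , b) e
    with refl ← trans (sym (fibres-class c i a))
                  (trans (Equivalence.to (classes (to (i , a)) (to (j , b))) (inj₂ e))
                    (fibres-class c j b)) =
    within λ { refl → irrefl H refl e }

-- Splitting off a universal vertex.

module _ (u : Fin (suc n)) where

  point⊎rest : ∀ {W : Set} → W ↔ Fin n → (Fin 1 ⊎ W) ↔ Fin (suc n)
  point⊎rest {W} g = mk↔ₛ′ to′ (λ v → back v (u ≟ v)) (λ v → to∘from v (u ≟ v)) from∘to
    where
    open Inverse g
    to′ : Fin 1 ⊎ W → Fin (suc n)
    to′ (inj₁ _) = u
    to′ (inj₂ w) = punchIn u (to w)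
    -- The decision is an argument, so that `to∘from` can be proved by cases on it.
    back : ∀ v → Dec (u ≡ v) → Fin 1 ⊎ W
    back v (yes _)  = inj₁ zero
    back v (no u≢v) = inj₂ (from (punchOut u≢v))
    to∘from : ∀ v d → to′ (back v d) ≡ v
    to∘from v (yes u≡v) = u≡v
    to∘from v (no u≢v)  = trans (cong (punchIn u) (strictlyInverseˡ _)) (punchIn-punchOut u≢v)
    from∘to : ∀ s → back (to′ s) (u ≟ to′ s) ≡ s
    from∘to (inj₁ zero) with u ≟ u
    ... | yes _  = refl
    ... | no u≢u = ⊥-elim (u≢u refl)
    from∘to (inj₂ w) with u ≟ punchIn u (to w)
    ... | yes u≡v = ⊥-elim (punchInᵢ≢i u (to w) (sym u≡v))
    ... | no u≢v  = cong inj₂ (trans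
      (cong from (trans (punchOut-cong u refl) (punchOut-punchIn u))) (strictlyInverseʳ w))

  induced : Graph (Fin (suc n)) → Graph (Fin n)
  induced G = record
    { Adj    = λ v w → Adj G (punchIn u v) (punchIn u w)
    ; adj?   = λ v w → adj? G (punchIn u v) (punchIn u w)
    ; symm   = symm G
    ; irrefl = λ v≡w → irrefl G (cong (punchIn u) v≡w)
    }

  universal⇒join : ∀ {W : Set} {H : Graph W} (G : Graph (Fin (suc n))) → Universal G u →
                   H ≅ induced G → join (K 1) H ≅ G
  universal⇒join {H = H} G univ (g , adj) = point⊎rest g , λ where
    (inj₁ zero) (inj₁ zero) → mk⇔ (λ 0≢0 → ⊥-elim (0≢0 refl)) (λ e → ⊥-elim (irrefl G refl e))
    (inj₁ _)    (inj₂ w)    → mk⇔ (λ _ → univ _ (≢-sym (punchInᵢ≢i u _))) (λ _ → tt)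
    (inj₂ w)    (inj₁ _)    → mk⇔ (λ _ → symm G (univ _ (≢-sym (punchInᵢ≢i u _)))) (λ _ → tt)
    (inj₂ v)    (inj₂ w)    → adj v w

-- From `Core` to the two families.

module _ (G : Graph (Fin (suc n))) (core : Core G) where

  open Core core

  -- The deleted matching is the complement of `G`: the pair `left`, `right` makes it non-empty and
  -- the universal centre keeps it from being perfect.
  core⇒cliqueMinusMatching : (∀ {x y z} → NonAdj G x y → NonAdj G x z → y ≡ z) →
                             IsCliqueMinusMatching G
  core⇒cliqueMinusMatching matching =
    _ , complement G , matching , (left , right , nonAdj) ,
    (λ perfect → let v , c≢v , c≁v = perfect centre in c≁v (universal v c≢v)) ,
    ↔-refl , λ u v → mk⇔
      (λ e → adj⇒≢ G e , λ (_ , u≁v) → u≁v e)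
      (λ (u≢v , ¬nonAdj) → decidable-stable (adj? G u v) λ u≁v → ¬nonAdj (u≢v , u≁v))

  module _ {x y z} (x≁y : NonAdj G x y) (x≁z : NonAdj G x z) (y≢z : y ≢ z) where

    -- If b is not the centre, a and c are the only non-neighbours of each
    -- other, so that x, a, y is an induced path whose middle is not the centre.
    inducedPath₂⇒centre : ∀ {a b c} → Adj G a b → Adj G b c → NonAdj G a c → b ≡ centre
    inducedPath₂⇒centre {a} {b} {c} a~b b~c a≁c = decidable-stable (b ≟ centre) λ b≢centre →
      let
        only-c : ∀ {w} → NonAdj G a w → w ≡ c
        only-c {w} a≁w = decidable-stable (w ≟ c) λ w≢c → b≢centre (forced a≁w a≁c w≢c a~b b~c a≁c)
        only-a : ∀ {w} → NonAdj G c w → w ≡ a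
        only-a {w} c≁w = decidable-stable (w ≟ a) λ w≢a →
          b≢centre (forced c≁w (NonAdj-sym G a≁c) w≢a (symm G b~c) (symm G a~b) (NonAdj-sym G a≁c))
        x≢a : x ≢ a
        x≢a = λ { refl → y≢z (trans (only-c x≁y) (sym (only-c x≁z))) }
        x≢c : x ≢ c
        x≢c = λ { refl → y≢z (trans (only-a x≁y) (sym (only-a x≁z))) }
        x~a : Adj G x a
        x~a = decidable-stable (adj? G x a) λ x≁a → x≢c (only-c (NonAdj-sym G (x≢a , x≁a)))
        a~y : Adj G a y
        a~y = decidable-stable (adj? G a y) λ a≁y →
          x≢a (only-a (subst (λ v → NonAdj G v x)
            (only-c (adj-nonAdj⇒≢ G x~a x≁y , a≁y)) (NonAdj-sym G x≁y)))
        a≢centre : a ≢ centre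
        a≢centre = λ { refl → proj₂ a≁c (universal c (proj₁ a≁c)) }
      in a≢centre (forced x≁y x≁z y≢z x~a a~y x≁y)

    -- Every induced path of length two has the centre as its middle, so none survives its removal
    -- and adjacency becomes transitive on distinct vertices. The non-adjacent pair yields at least
    -- two cliques.
    core⇒K₁JoinCliques : IsK₁JoinCliques G
    core⇒K₁JoinCliques =
      let k , m , nonEmpty , iso = cluster⇒cliques (induced centre G) cluster in
      k , m , nonAdj⇒2≤k m _ _ (NonAdj-≅ {G = G} {K₁JoinCliques m} (G≅ iso) nonAdj) , nonEmpty , G≅ iso
      where
      cluster : ∀ {a b c} → Adj (induced centre G) a b → Adj (induced centre G) b c → a ≢ c →
                Adj (induced centre G) a c
      cluster {a} {b} {c} a~b b~c a≢c = decidable-stable (adj? (induced centre G) a c) λ a≁c →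
        punchInᵢ≢i centre b (inducedPath₂⇒centre a~b b~c (a≢c ∘ punchIn-injective centre a c , a≁c))

      G≅ : ∀ {k} {m : Fin k → ℕ} → (⨆ λ i → K (m i)) ≅ induced centre G → G ≅ K₁JoinCliques m
      G≅ {m = m} iso = ≅-sym {G = K₁JoinCliques m} {G} (universal⇒join centre G universal iso)

  core⇒families : IsCliqueMinusMatching G ⊎ IsK₁JoinCliques G
  core⇒families with any? (twoNonNeighbours? G)
  ... | yes (_ , _ , _ , x≁y , x≁z , y≢z) = inj₂ (core⇒K₁JoinCliques x≁y x≁z y≢z)
  ... | no none = inj₁ (core⇒cliqueMinusMatching λ {x} {y} {z} x≁y x≁z →
          decidable-stable (y ≟ z) λ y≢z → none (x , y , z , x≁y , x≁z , y≢z))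

families⇒core : ∀ {G : Graph (Fin n)} → IsCliqueMinusMatching G ⊎ IsK₁JoinCliques G → Core G
families⇒core {G = G} (inj₁ (m , M , matching , nonEmpty , ¬perfect , iso)) =
  core-≅ {G = G} iso (cliqueMinusMatching-core M matching nonEmpty ¬perfect)
families⇒core {G = G} (inj₂ (k , m , 2≤k , nonEmpty , iso)) =
  core-≅ {G = G} iso (K₁JoinCliques-core m 2≤k nonEmpty)

theorem4p5 : ∀ (n : ℕ) → 4 ≤ n → (G : Graph (Fin n)) → Connected G →
    (IsVp⁻ G (n ∸ 2) × IsVp G (n ∸ 1)) ⇔ (IsCliqueMinusMatching G ⊎ IsK₁JoinCliques G)
theorem4p5 (suc (suc n)) (s≤s (s≤s _)) G conn = mk⇔
  (λ (vp⁻ , vp) → core⇒families G (vp⇒core G conn vp⁻ vp))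
  (λ families → core⇒vp G (families⇒core families))
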